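{- Let $\Sigma=(\mathcal F_\Sigma;\mathcal P_\Sigma)$ be a signature such that both $\mathcal F_\Sigma$ and $\mathcal P_\Sigma$ are data types. Then the predicate $\mathsf{FSAT}(\Sigma)$ on formulas over $\Sigma$ is enumerable.
   Context: We work in constructive type theory (as in Coq), where all definable functions are computable. A type $X$ is enumerable if there is $f:\mathbb N\to\mathbb O\,X$ such that every $x$ satisfies $f\,n=\mathsf{some}\,x$ for some $n$. A type is discrete if its equality is decidable, and a data type if it is both enumerable and discrete. A predicate $p:X\to\mathbb P$ is enumerable if there is $f:\mathbb N\to\mathbb O\,X$ with $p\,x\leftrightarrow\exists n.\,f\,n=\mathsf{some}\,x$. A predicate is decidable if a Boolean function characterises it. A type is finite if some list contains all of its elements. A signature $\Sigma=(\mathcal F_\Sigma;\mathcal P_\Sigma)$ is a type of function symbols and a type of relation symbols, each symbol carrying an arity in $\mathbb N$. Terms are variables or function symbols applied to the correct number of terms. Formulas are built from $\dot\bot$, atoms, $\dot\to,\dot\land,\dot\lor,\dot\forall,\dot\exists$. A model over a domain type $D$ interprets each $f$ as a function $D^{|f|}\to D$ and each $P$ as a predicate $D^{|P|}\to\mathbb P$. Satisfaction $\mathcal M\vDash_\rho\varphi$ under $\rho:\mathbb N\to D$ is the Tarski semantics. A model is decidable if every relation interpretation is decidable. $\mathsf{FSAT}(\Sigma)\,\varphi$ holds iff there exist a finite type $D$, a decidable model $\mathcal M$ over $D$ and $\rho$ with $\mathcal M\vDash_\rho\varphi$. -}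

module Defs where

open import Data.Empty.Polymorphic using (⊥)
open import Data.List.Base using (List)
open import Data.List.Relation.Unary.Enumerates.Setoid using (IsEnumeration)
open import Data.Maybe.Base using (Maybe; just)
open import Data.Nat.Base using (ℕ; zero; suc)
open import Data.Product.Base using (∃; ∃-syntax; _×_)
open import Data.Sum.Base using (_⊎_)
open import Data.Vec.Base using (Vec; []; _∷_)
open import Function.Bundles using (_⇔_)
open import Level using (Level; _⊔_) renaming (suc to lsuc)
open import Relation.Binary.Definitions using (DecidableEquality)
open import Relation.Binary.PropositionalEquality.Core using (_≡_)
open import Relation.Binary.PropositionalEquality.Properties using (setoid)
open import Relation.Unary using (Pred; Decidable)

private
  variable
    a f p ℓ : Level

EnumerableType : Set a → Set a
EnumerableType X =
  ∃ λ (e : ℕ → Maybe X) → ∀ x → ∃[ n ] e n ≡ just x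

EnumerablePred : {X : Set a} → Pred X ℓ → Set (a ⊔ ℓ)
EnumerablePred {X = X} P =
  ∃ λ (e : ℕ → Maybe X) → ∀ x → P x ⇔ (∃[ n ] e n ≡ just x)

DataType : Set a → Set a
DataType X = EnumerableType X × DecidableEquality X

FiniteType : Set a → Set a
FiniteType X = ∃ λ (xs : List X) → IsEnumeration (setoid X) xs

record Signature (f p : Level) : Set (lsuc (f ⊔ p)) where
  field
    Fun      : Set f
    Rel      : Set p
    funArity : Fun → ℕ
    relArity : Rel → ℕ

module _ (S : Signature f p) where
  open Signature S

  data Term : Set f where
    var : ℕ → Term
    app : (g : Fun) → Vec Term (funArity g) → Term

  infixr 7 _∧̇_
  infixr 6 _∨̇_
  infixr 5 _→̇_

  -- Variables are de Bruijn indices: ∀̇ and ∃̇ bind index 0 of their body.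
  data Formula : Set (f ⊔ p) where
    ⊥̇              : Formula
    atom           : (R : Rel) → Vec Term (relArity R) → Formula
    _→̇_ _∧̇_ _∨̇_ : Formula → Formula → Formula
    ∀̇ ∃̇           : Formula → Formula

  record Model (D : Set ℓ) : Set (f ⊔ p ⊔ lsuc ℓ) where
    field
      funᴵ : (g : Fun) → Vec D (funArity g) → D
      relᴵ : (R : Rel) → Pred (Vec D (relArity R)) ℓ

infixr 5 _·_

_·_ : {D : Set ℓ} → D → (ℕ → D) → ℕ → D
(d · ρ) zero    = d
(d · ρ) (suc n) = ρ n

module _ {S : Signature f p} {D : Set ℓ} (M : Model S D) where
  open Signature S
  open Model M

  -- evals is Vec.map (eval ρ), unfolded for the termination checker.
  mutual
    eval : (ℕ → D) → Term S → D
    eval ρ (var n)    = ρ n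
    eval ρ (app g ts) = funᴵ g (evals ρ ts)

    evals : ∀ {n} → (ℕ → D) → Vec (Term S) n → Vec D n
    evals ρ []       = []
    evals ρ (t ∷ ts) = eval ρ t ∷ evals ρ ts

  Satisfies : (ℕ → D) → Formula S → Set ℓ
  Satisfies ρ ⊥̇           = ⊥
  Satisfies ρ (atom R ts) = relᴵ R (evals ρ ts)
  Satisfies ρ (φ →̇ ψ)     = Satisfies ρ φ → Satisfies ρ ψ
  Satisfies ρ (φ ∧̇ ψ)     = Satisfies ρ φ × Satisfies ρ ψ
  Satisfies ρ (φ ∨̇ ψ)     = Satisfies ρ φ ⊎ Satisfies ρ ψ
  Satisfies ρ (∀̇ φ)       = ∀ d → Satisfies (d · ρ) φ
  Satisfies ρ (∃̇ φ)       = ∃[ d ] Satisfies (d · ρ) φ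

  DecidableModel : Set (p ⊔ ℓ)
  DecidableModel = ∀ R → Decidable (relᴵ R)

-- ℓ is the universe of the domains and of the truth values of relations.
FSAT : (ℓ : Level) (S : Signature f p) → Pred (Formula S) (f ⊔ p ⊔ lsuc ℓ)
FSAT ℓ S φ =
  ∃ λ (D : Set ℓ) → FiniteType D ×
  ∃ λ (M : Model S D) → DecidableModel M ×
  ∃ λ (ρ : ℕ → D) → Satisfies M ρ φ

{-# OPTIONS --safe #-}
-- No quotient is needed to make a finite domain discrete: a list xs enumerating
-- D comes with a position for every element, that is, with a section of the
-- surjection π = lookup xs : Fin (length xs) → D.  Pulling relations back along
-- π, and functions back along π followed by the section, gives a model on
-- Fin (length xs) with the same satisfied formulas, since equality is not a
-- logical symbol.  A formula only sees finitely many symbols and variables, so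
-- the pulled-back model can be replaced by one read off a finite tree of lookup
-- tables.  Hence φ is finitely satisfiable iff some tree encodes a model of φ,
-- which is a decidable property of the tree and φ.
module Submission where

open import Defs
open import Data.Empty.Polymorphic using (⊥)
open import Data.Fin.Base using (Fin; toℕ)
open import Data.Fin.Properties using (toℕ<n; toℕ-injective; toℕ-fromℕ<)
open import Data.List.Base using ([]; _∷_; allFin; length; lookup; map)
open import Data.List.Membership.Propositional.Properties using (∈-allFin; ∈-map⁺)
open import Data.List.Relation.Unary.All as All using (all?)
open import Data.List.Relation.Unary.Any as Any using (any?; index; satisfied)
open import Data.List.Relation.Unary.Any.Properties using (lookup-index)
open import Data.Maybe.Base as Maybe using (Maybe; just; nothing; _>>=_; zipWith)
open import Data.Nat.Base using (ℕ; zero; suc; _+_; _⊔_; _≤_; _<_; s≤s⁻¹)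
open import Data.Nat.DivMod using (_mod_; m<n⇒m%n≡m)
open import Data.Nat.Properties using
  (+-identityʳ; +-suc; suc-injective; ≤-refl; <⇒≤; m⊔n≤o⇒m≤o; m⊔n≤o⇒n≤o)
open import Data.Product.Base using (∃; ∃-syntax; _×_; _,_; proj₁; proj₂)
open import Data.Product.Function.NonDependent.Propositional using (_×-⇔_)
open import Data.Sum.Function.Propositional using (_⊎-⇔_)
open import Data.Unit.Polymorphic using (⊤)
open import Data.Vec.Base as Vec using (Vec; []; _∷_)
open import Function.Base using (_∘_)
open import Function.Bundles using (_⇔_; mk⇔; Equivalence)
open import Function.Construct.Composition using (_⇔-∘_)
open import Function.Construct.Identity using (⇔-id)
open import Function.Related.TypeIsomorphisms using (→-cong-⇔)
open import Level using (Level; Lift; lift)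
open import Relation.Binary.PropositionalEquality
  using (_≡_; refl; sym; trans; cong; cong₂; subst; module ≡-Reasoning)
open import Relation.Nullary using (Dec; yes; no; contradiction; map′; _×-dec_; _⊎-dec_; _→-dec_)
open import Relation.Nullary.Decidable using (dec⇒maybe)
open import Relation.Unary using (Pred; Decidable)

private
  variable
    a b f p q ℓ : Level
    X : Set a
    Y : Set b

open Equivalence using (to; from)

-- Enumeration of pairs and trees

-- Walks the diagonals a + b = s in order of increasing s.
unpair : ℕ → ℕ × ℕ
unpair zero    = zero , zero
unpair (suc n) = step (unpair n)
  where
  step : ℕ × ℕ → ℕ × ℕ
  step (a , zero)  = zero , suc a
  step (a , suc b) = suc a , b

-- Induction on the diagonal, then on `a`: `(suc a , b)` comes right after `(a , suc b)`, and
-- `(0 , suc b)` right after `(b , 0)`, the end of the previous diagonal.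
unpair-surjective : ∀ a b → ∃[ n ] unpair n ≡ (a , b)
unpair-surjective a b = onDiagonal (a + b) a b refl
  where
  onDiagonal : ∀ s a b → a + b ≡ s → ∃[ n ] unpair n ≡ (a , b)
  onDiagonal zero    zero    zero    _  = zero , refl
  onDiagonal (suc s) zero    (suc b) eq
    with n , p ← onDiagonal s b zero (trans (+-identityʳ b) (suc-injective eq))
    = suc n , lemma
    where
    lemma : unpair (suc n) ≡ (zero , suc b)
    lemma rewrite p = refl
  onDiagonal s       (suc a) b       eq
    with n , p ← onDiagonal s a (suc b) (trans (+-suc a b) eq)
    = suc n , lemma
    where
    lemma : unpair (suc n) ≡ (suc a , b)
    lemma rewrite p = refl

-- One code type serves for terms, formulas, lookup tables and whole models.
data Tree : Set where
  leaf : ℕ → Tree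
  node : Tree → Tree → Tree

height : Tree → ℕ
height (leaf _)   = zero
height (node s t) = suc (height s ⊔ height t)

-- Recursion on a height budget instead of the code makes termination immediate. Below a positive
-- budget, a first component of zero marks a leaf.
treeUpTo : ℕ → ℕ → Tree
treeUpTo zero    c = leaf c
treeUpTo (suc h) c with unpair c
... | zero  , n = leaf n
... | suc m , n = node (treeUpTo h m) (treeUpTo h n)

treeUpTo-surjective : ∀ h t → height t ≤ h → ∃[ c ] treeUpTo h c ≡ t
treeUpTo-surjective zero    (leaf n)   _ = n , refl
treeUpTo-surjective (suc h) (leaf n)   _
  with c , p ← unpair-surjective zero n = c , lemma
  where
  lemma : treeUpTo (suc h) c ≡ leaf n
  lemma rewrite p = refl
treeUpTo-surjective (suc h) (node s t) le
  with m , p ← treeUpTo-surjective h s (m⊔n≤o⇒m≤o _ _ (s≤s⁻¹ le))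
     | n , q ← treeUpTo-surjective h t (m⊔n≤o⇒n≤o _ _ (s≤s⁻¹ le))
  with c , r ← unpair-surjective (suc m) n
  = c , lemma
  where
  lemma : treeUpTo (suc h) c ≡ node s t
  lemma rewrite r = cong₂ node p q

tree-enumerable : EnumerableType Tree
tree-enumerable = e , e-surjective
  where
  e : ℕ → Maybe Tree
  e n with h , c ← unpair n = just (treeUpTo h c)

  e-surjective : ∀ t → ∃[ n ] e n ≡ just t
  e-surjective t
    with c , p ← treeUpTo-surjective (height t) t ≤-refl
    with n , q ← unpair-surjective (height t) c
    = n , lemma
    where
    lemma : e n ≡ just t
    lemma rewrite q = cong just p

decodable⇒enumerable : (d : Tree → Maybe X) → (∀ x → ∃[ t ] d t ≡ just x) →
                       EnumerableType X
decodable⇒enumerable d d-surjective with e , e-surjective ← tree-enumerable =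
  (λ n → e n >>= d) , λ x →
    let t , p = d-surjective x
        n , q = e-surjective t
    in n , trans (cong (_>>= d) q) p

-- Dovetailing: each step tests one pair of candidates and outputs `x` if the test succeeds.
∃-enumerable : EnumerableType X → EnumerableType Y →
               {Q : X → Y → Set q} → (∀ x y → Dec (Q x y)) →
               EnumerablePred (λ x → ∃ (Q x))
∃-enumerable {X = X} {Y = Y} (eˣ , surjˣ) (eʸ , surjʸ) {Q} Q? =
  e , λ x → mk⇔ complete λ (n , p) →
    sound (eˣ (proj₁ (unpair n))) (eʸ (proj₂ (unpair n))) p
  where
  check : Maybe X → Maybe Y → Maybe X
  check (just x) (just y) = Maybe.map (λ _ → x) (dec⇒maybe (Q? x y))
  check _        _        = nothing

  e : ℕ → Maybe X
  e n with i , j ← unpair n = check (eˣ i) (eʸ j)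

  sound : ∀ mx my {x} → check mx my ≡ just x → ∃ (Q x)
  sound (just x) (just y) p with yes Qxy ← Q? x y | refl ← p = y , Qxy

  check-just : ∀ {x y} → Q x y → check (just x) (just y) ≡ just x
  check-just {x} {y} Qxy with Q? x y
  ... | yes _  = refl
  ... | no ¬Qxy with () ← ¬Qxy Qxy

  complete : ∀ {x} → ∃ (Q x) → ∃[ n ] e n ≡ just x
  complete {x} (y , Qxy)
    with i , p ← surjˣ x | j , q ← surjʸ y
    with n , r ← unpair-surjective i j = n , lemma
    where
    lemma : e n ≡ just x
    lemma rewrite r | p | q = check-just Qxy

enumerable-resp-⇔ : {P : Pred X p} {Q : Pred X q} →
                    (∀ x → P x ⇔ Q x) → EnumerablePred Q → EnumerablePred P
enumerable-resp-⇔ P⇔Q (e , Q⇔e) = e , λ x → Q⇔e x ⇔-∘ P⇔Q x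

-- Enumeration of formulas

module _ {S : Signature f p} where
  open Signature S

  module _ (Fun-enumerable : EnumerableType Fun) (Rel-enumerable : EnumerableType Rel) where

    private
      funAt = proj₁ Fun-enumerable
      relAt = proj₁ Rel-enumerable

    mutual
      -- A symbol is stored as an index into its enumeration; the arity of the decoded symbol
      -- dictates how many arguments are read.
      decodeTerm : Tree → Maybe (Term S)
      decodeTerm (leaf n)            = just (var n)
      decodeTerm (node (leaf n) t)   = funAt n >>= λ g → Maybe.map (app g) (decodeTerms _ t)
      decodeTerm (node (node _ _) _) = nothing

      decodeTerms : ∀ k → Tree → Maybe (Vec (Term S) k)
      decodeTerms zero    _          = just []
      decodeTerms (suc k) (leaf _)   = nothing
      decodeTerms (suc k) (node s t) = zipWith _∷_ (decodeTerm s) (decodeTerms k t)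

    mutual
      decodeTerm-surjective : ∀ t → ∃[ c ] decodeTerm c ≡ just t
      decodeTerm-surjective (var n)    = leaf n , refl
      decodeTerm-surjective (app g ts)
        with n , p ← proj₂ Fun-enumerable g | c , q ← decodeTerms-surjective ts
        = node (leaf n) c , lemma
        where
        lemma : decodeTerm (node (leaf n) c) ≡ just (app g ts)
        lemma rewrite p | q = refl

      decodeTerms-surjective : ∀ {k} (ts : Vec (Term S) k) →
                               ∃[ c ] decodeTerms k c ≡ just ts
      decodeTerms-surjective []       = leaf zero , refl
      decodeTerms-surjective (t ∷ ts)
        with c , p ← decodeTerm-surjective t | d , q ← decodeTerms-surjective ts
        = node c d , cong₂ (zipWith _∷_) p q

    decodeFormula : Tree → Maybe (Formula S)
    decodeFormula (node (leaf 0) (node (leaf n) t)) =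
      relAt n >>= λ R → Maybe.map (atom R) (decodeTerms _ t)
    decodeFormula (node (leaf 1) (node s t)) = zipWith _→̇_ (decodeFormula s) (decodeFormula t)
    decodeFormula (node (leaf 2) (node s t)) = zipWith _∧̇_ (decodeFormula s) (decodeFormula t)
    decodeFormula (node (leaf 3) (node s t)) = zipWith _∨̇_ (decodeFormula s) (decodeFormula t)
    decodeFormula (node (leaf 4) t)          = Maybe.map ∀̇ (decodeFormula t)
    decodeFormula (node (leaf 5) t)          = Maybe.map ∃̇ (decodeFormula t)
    -- This catch-all covers `leaf 0`, the code chosen for `⊥̇`. Malformed codes may decode to any
    -- formula, since only surjectivity matters.
    decodeFormula _                          = just ⊥̇

    decodeFormula-surjective : ∀ φ → ∃[ c ] decodeFormula c ≡ just φ
    decodeFormula-surjective ⊥̇ = leaf 0 , refl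
    decodeFormula-surjective (atom R ts)
      with n , p ← proj₂ Rel-enumerable R | c , q ← decodeTerms-surjective ts
      = node (leaf 0) (node (leaf n) c) , lemma
      where
      lemma : decodeFormula (node (leaf 0) (node (leaf n) c)) ≡ just (atom R ts)
      lemma rewrite p | q = refl
    decodeFormula-surjective (φ →̇ ψ)
      with c , p ← decodeFormula-surjective φ | d , q ← decodeFormula-surjective ψ
      = node (leaf 1) (node c d) , cong₂ (zipWith _→̇_) p q
    decodeFormula-surjective (φ ∧̇ ψ)
      with c , p ← decodeFormula-surjective φ | d , q ← decodeFormula-surjective ψ
      = node (leaf 2) (node c d) , cong₂ (zipWith _∧̇_) p q
    decodeFormula-surjective (φ ∨̇ ψ)
      with c , p ← decodeFormula-surjective φ | d , q ← decodeFormula-surjective ψ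
      = node (leaf 3) (node c d) , cong₂ (zipWith _∨̇_) p q
    decodeFormula-surjective (∀̇ φ) with c , p ← decodeFormula-surjective φ
      = node (leaf 4) c , cong (Maybe.map ∀̇) p
    decodeFormula-surjective (∃̇ φ) with c , p ← decodeFormula-surjective φ
      = node (leaf 5) c , cong (Maybe.map ∃̇) p

    formula-enumerable : EnumerableType (Formula S)
    formula-enumerable = decodable⇒enumerable decodeFormula decodeFormula-surjective

-- Satisfaction in finite decidable models

∀-dec : {D : Set ℓ} {P : Pred D q} → FiniteType D → Decidable P → Dec (∀ d → P d)
∀-dec (xs , _∈xs) P? =
  map′ (λ ps d → All.lookup ps (d ∈xs)) (λ ps → All.tabulate λ {d} _ → ps d) (all? P? xs)

∃-dec : {D : Set ℓ} {P : Pred D q} → FiniteType D → Decidable P → Dec (∃ P)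
∃-dec {P = P} (xs , _∈xs) P? =
  map′ satisfied (λ (d , p) → Any.map (λ eq → subst P eq p) (d ∈xs)) (any? P? xs)

satisfies? : {S : Signature f p} {D : Set ℓ} (M : Model S D) →
             FiniteType D → DecidableModel M →
             ∀ ρ φ → Dec (Satisfies M ρ φ)
satisfies? M fin rel? ρ ⊥̇           = no λ ()
satisfies? M fin rel? ρ (atom R ts) = rel? R (evals M ρ ts)
satisfies? M fin rel? ρ (φ →̇ ψ)     = satisfies? M fin rel? ρ φ →-dec satisfies? M fin rel? ρ ψ
satisfies? M fin rel? ρ (φ ∧̇ ψ)     = satisfies? M fin rel? ρ φ ×-dec satisfies? M fin rel? ρ ψ
satisfies? M fin rel? ρ (φ ∨̇ ψ)     = satisfies? M fin rel? ρ φ ⊎-dec satisfies? M fin rel? ρ ψ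
satisfies? M fin rel? ρ (∀̇ φ)       = ∀-dec fin λ d → satisfies? M fin rel? (d · ρ) φ
satisfies? M fin rel? ρ (∃̇ φ)       = ∃-dec fin λ d → satisfies? M fin rel? (d · ρ) φ

-- Transfer along a surjection that is a homomorphism on the symbols in use

module _ {S : Signature f p} where
  open Signature S
  open Model

  module _ (funRank : Fun → ℕ) (relRank : Rel → ℕ) where

    mutual
      -- The successors make the bound strict, so that `≤ N` yields an index or rank `< N`, the
      -- range that a table of `N` entries covers.
      termBound : Term S → ℕ
      termBound (var n)    = suc n
      termBound (app g ts) = suc (funRank g) ⊔ termsBound ts

      termsBound : ∀ {k} → Vec (Term S) k → ℕ
      termsBound []       = zero
      termsBound (t ∷ ts) = termBound t ⊔ termsBound ts

    bound : Formula S → ℕ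
    bound ⊥̇           = zero
    bound (atom R ts) = suc (relRank R) ⊔ termsBound ts
    bound (φ →̇ ψ)     = bound φ ⊔ bound ψ
    bound (φ ∧̇ ψ)     = bound φ ⊔ bound ψ
    bound (φ ∨̇ ψ)     = bound φ ⊔ bound ψ
    -- A binder keeps the bound: free indices are overestimated, but one `N` serves the whole
    -- induction on formulas.
    bound (∀̇ φ)       = bound φ
    bound (∃̇ φ)       = bound φ

    module _ {D E : Set ℓ} (M : Model S D) (M′ : Model S E) (N : ℕ)
             (π : E → D) (σ : D → E) (π∘σ : ∀ d → π (σ d) ≡ d)
             (fun-hom : ∀ g → funRank g < N → ∀ v →
                        π (funᴵ M′ g v) ≡ funᴵ M g (Vec.map π v))
             (rel-hom : ∀ R → relRank R < N → ∀ v →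
                        relᴵ M′ R v ⇔ relᴵ M R (Vec.map π v))
             where

      private
        _∼_ : (ℕ → E) → (ℕ → D) → Set _
        ρ′ ∼ ρ = ∀ i → i < N → π (ρ′ i) ≡ ρ i

        ·-cong : ∀ {e d ρ′ ρ} → π e ≡ d → ρ′ ∼ ρ → (e · ρ′) ∼ (d · ρ)
        ·-cong p ρ′∼ρ zero    _  = p
        ·-cong p ρ′∼ρ (suc i) lt = ρ′∼ρ i (<⇒≤ lt)

      mutual
        eval-transfer : ∀ {ρ′ ρ} → ρ′ ∼ ρ → ∀ t → termBound t ≤ N →
                        π (eval M′ ρ′ t) ≡ eval M ρ t
        eval-transfer ρ′∼ρ (var n)    le = ρ′∼ρ n le
        eval-transfer ρ′∼ρ (app g ts) le =
          trans (fun-hom g (m⊔n≤o⇒m≤o _ (termsBound ts) le) _)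
                (cong (funᴵ M g) (evals-transfer ρ′∼ρ ts (m⊔n≤o⇒n≤o (suc (funRank g)) _ le)))

        evals-transfer : ∀ {ρ′ ρ k} → ρ′ ∼ ρ → ∀ (ts : Vec (Term S) k) → termsBound ts ≤ N →
                         Vec.map π (evals M′ ρ′ ts) ≡ evals M ρ ts
        evals-transfer ρ′∼ρ []       le = refl
        evals-transfer ρ′∼ρ (t ∷ ts) le =
          cong₂ _∷_ (eval-transfer ρ′∼ρ t (m⊔n≤o⇒m≤o _ _ le))
                    (evals-transfer ρ′∼ρ ts (m⊔n≤o⇒n≤o (termBound t) _ le))

      -- Induction on `φ` for all related assignments. In the quantifier cases `e` in `E` stands for
      -- `π e`, and `d` in `D` is represented by `σ d`. Proving both directions at once handles the
      -- contravariance of implication.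
      satisfies-transfer : ∀ {ρ′ ρ} → ρ′ ∼ ρ → ∀ φ → bound φ ≤ N →
                           Satisfies M′ ρ′ φ ⇔ Satisfies M ρ φ
      satisfies-transfer ρ′∼ρ ⊥̇ le = ⇔-id _
      satisfies-transfer {ρ′} {ρ} ρ′∼ρ (atom R ts) le =
        subst (λ v → relᴵ M′ R (evals M′ ρ′ ts) ⇔ relᴵ M R v)
              (evals-transfer ρ′∼ρ ts (m⊔n≤o⇒n≤o (suc (relRank R)) _ le))
              (rel-hom R (m⊔n≤o⇒m≤o _ (termsBound ts) le) (evals M′ ρ′ ts))
      satisfies-transfer ρ′∼ρ (φ →̇ ψ) le =
        →-cong-⇔ (satisfies-transfer ρ′∼ρ φ (m⊔n≤o⇒m≤o _ _ le))
                 (satisfies-transfer ρ′∼ρ ψ (m⊔n≤o⇒n≤o (bound φ) _ le))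
      satisfies-transfer ρ′∼ρ (φ ∧̇ ψ) le =
        satisfies-transfer ρ′∼ρ φ (m⊔n≤o⇒m≤o _ _ le) ×-⇔
        satisfies-transfer ρ′∼ρ ψ (m⊔n≤o⇒n≤o (bound φ) _ le)
      satisfies-transfer ρ′∼ρ (φ ∨̇ ψ) le =
        satisfies-transfer ρ′∼ρ φ (m⊔n≤o⇒m≤o _ _ le) ⊎-⇔
        satisfies-transfer ρ′∼ρ ψ (m⊔n≤o⇒n≤o (bound φ) _ le)
      satisfies-transfer ρ′∼ρ (∀̇ φ) le = mk⇔
        (λ h d → to   (satisfies-transfer (·-cong (π∘σ d) ρ′∼ρ) φ le) (h (σ d)))
        (λ h e → from (satisfies-transfer (·-cong refl ρ′∼ρ) φ le) (h (π e)))
      satisfies-transfer ρ′∼ρ (∃̇ φ) le = mk⇔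
        (λ (e , h) → π e , to   (satisfies-transfer (·-cong refl ρ′∼ρ) φ le) h)
        (λ (d , h) → σ d , from (satisfies-transfer (·-cong (π∘σ d) ρ′∼ρ) φ le) h)

-- Trees as lookup tables

-- A tree is read as the list of left children along its right spine; the default makes every tree a
-- total table.
get : Tree → ℕ → Tree
get (leaf _)   _       = leaf zero
get (node s t) zero    = s
get (node s t) (suc n) = get t n

tabulate : (ℕ → Tree) → ℕ → Tree
tabulate h zero    = leaf zero
tabulate h (suc N) = node (h zero) (tabulate (h ∘ suc) N)

get-tabulate : ∀ h {N n} → n < N → get (tabulate h N) n ≡ h n
get-tabulate h {suc N} {zero}  _  = refl
get-tabulate h {suc N} {suc n} lt = get-tabulate (h ∘ suc) (s≤s⁻¹ lt)

label : Tree → ℕ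
label (leaf n)   = n
label (node _ _) = zero

-- Truth values are coded by shape, so every tree used as a table gives a decidable relation.
IsLeaf : Pred Tree ℓ
IsLeaf (leaf _)   = ⊤
IsLeaf (node _ _) = ⊥

isLeaf? : Decidable (IsLeaf {ℓ})
isLeaf? (leaf _)   = yes _
isLeaf? (node _ _) = no λ ()

encodeDec : {A : Set a} → Dec A → Tree
encodeDec (yes _) = leaf zero
encodeDec (no _)  = node (leaf zero) (leaf zero)

isLeaf-encodeDec : {A : Set a} (A? : Dec A) → IsLeaf {ℓ} (encodeDec A?) ⇔ A
isLeaf-encodeDec (yes x) = mk⇔ (λ _ → x) _
isLeaf-encodeDec (no ¬x) = mk⇔ (λ ()) (λ x → contradiction x ¬x)

toℕ-mod : ∀ {m} (i : Fin (suc m)) → toℕ i mod suc m ≡ i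
toℕ-mod {m} i = toℕ-injective (trans (toℕ-fromℕ< _) (m<n⇒m%n≡m (toℕ<n i)))

module _ {m : ℕ} where

  private
    E : (ℓ : Level) → Set ℓ
    E ℓ = Lift ℓ (Fin (suc m))

  -- Reduction modulo the size of the domain, which is never zero, lets an arbitrary tree denote an
  -- element.
  element : Tree → E ℓ
  element t = lift (label t mod suc m)

  name : E ℓ → Tree
  name (lift i) = leaf (toℕ i)

  element-name : ∀ (e : E ℓ) → element (name e) ≡ e
  element-name (lift i) = cong lift (toℕ-mod i)

  query : ∀ {k} → Tree → Vec (E ℓ) k → Tree
  query t []           = t
  query t (lift i ∷ v) = query (get t (toℕ i)) v

  -- Induction on the arity: a table is a list of tables, one for each value of the first argument.
  query-surjective : ∀ {k} (H : Vec (E ℓ) k → Tree) → ∃[ t ] (∀ v → query t v ≡ H v)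
  query-surjective {k = zero}  H = H [] , λ where [] → refl
  query-surjective {ℓ} {suc k} H = tabulate row (suc m) , correct
    where
    -- Rows are indexed by ℕ to fit `tabulate`; `mod` returns to the domain and is undone by
    -- `toℕ-mod`.
    rows : (i : ℕ) → ∃[ t ] (∀ v → query t v ≡ H (lift (i mod suc m) ∷ v))
    rows i = query-surjective (λ v → H (lift (i mod suc m) ∷ v))

    row : ℕ → Tree
    row = proj₁ ∘ rows

    correct : ∀ v → query (tabulate row (suc m)) v ≡ H v
    correct (lift i ∷ v) = begin
      query (get (tabulate row (suc m)) (toℕ i)) v
        ≡⟨ cong (λ t → query t v) (get-tabulate row (toℕ<n i)) ⟩
      query (row (toℕ i)) v
        ≡⟨ proj₂ (rows (toℕ i)) v ⟩
      H (lift (toℕ i mod suc m) ∷ v)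
        ≡⟨ cong (λ j → H (lift j ∷ v)) (toℕ-mod i) ⟩
      H (lift i ∷ v) ∎
      where open ≡-Reasoning

lift-fin-finite : ∀ m → FiniteType (Lift ℓ (Fin m))
lift-fin-finite m = map lift (allFin m) , λ (lift i) → ∈-map⁺ lift (∈-allFin i)

-- Finite models coded as trees

module _ {S : Signature f p} where
  open Signature S
  open Model

  module _ (Fun-enumerable : EnumerableType Fun) (Rel-enumerable : EnumerableType Rel) where

    funRank : Fun → ℕ
    funRank g = proj₁ (proj₂ Fun-enumerable g)

    relRank : Rel → ℕ
    relRank R = proj₁ (proj₂ Rel-enumerable R)

    tableModel : ∀ m → Tree → Tree → Model S (Lift ℓ (Fin (suc m)))
    tableModel m F R .funᴵ g v = element (query (get F (funRank g)) v)
    tableModel m F R .relᴵ P v = IsLeaf (query (get R (relRank P)) v)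

    tableModel-decidable : ∀ m F R → DecidableModel (tableModel {ℓ} m F R)
    tableModel-decidable m F R P v = isLeaf? (query (get R (relRank P)) v)

    tableAssignment : ∀ m → Tree → ℕ → Lift ℓ (Fin (suc m))
    tableAssignment m V n = element (get V n)

    -- The entries of `t` are the domain size minus one, the function tables, the relation tables
    -- and the values of the variables.
    SatisfiedBy : ∀ ℓ → Formula S → Tree → Set ℓ
    SatisfiedBy ℓ φ t =
      Satisfies (tableModel m (get t 1) (get t 2)) (tableAssignment m (get t 3)) φ
      where m = label (get t 0)

    satisfiedBy? : ∀ φ t → Dec (SatisfiedBy ℓ φ t)
    satisfiedBy? φ t =
      satisfies? _ (lift-fin-finite _) (tableModel-decidable _ (get t 1) (get t 2)) _ φ

    -- Entry `n` is computed from `e n`. At the rank of `x` this is `just x`, so the default only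
    -- fills positions that are no symbol's rank.
    tabulateBySymbol : ∀ {X : Set a} ((e , e-surj) : EnumerableType X) (T : X → Tree) N →
                       ∃[ t ] (∀ x → proj₁ (e-surj x) < N → get t (proj₁ (e-surj x)) ≡ T x)
    tabulateBySymbol {X = X} (e , e-surj) T N = tabulate (row ∘ e) N , λ x lt →
      trans (get-tabulate (row ∘ e) lt) (cong row (proj₂ (e-surj x)))
      where
      row : Maybe X → Tree
      row = Maybe.maybe′ T (leaf zero)

    FSAT⇒satisfiedBy : ∀ φ → FSAT ℓ S φ → ∃ (SatisfiedBy ℓ φ)
    -- The assignment already supplies an element, so the domain is nonempty.
    FSAT⇒satisfiedBy φ (D , ([] , _∈xs) , M , rel? , ρ , sat) with () ← ρ zero ∈xs
    FSAT⇒satisfiedBy {ℓ} φ (D , (xs@(_ ∷ xs′) , _∈xs) , M , rel? , ρ , sat) =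
      node (leaf m) (node F (node R (node V (leaf zero)))) ,
      from (satisfies-transfer funRank relRank M (tableModel m F R) N π σ π∘σ fun-hom rel-hom
              assignment-agrees φ ≤-refl)
           sat
      where
      m = length xs′
      N = bound funRank relRank φ
      E = Lift ℓ (Fin (suc m))

      π : E → D
      π (lift i) = lookup xs i

      σ : D → E
      σ d = lift (index (d ∈xs))

      π∘σ : ∀ d → π (σ d) ≡ d
      π∘σ d = sym (lookup-index (d ∈xs))

      -- Tables store the pullback: arguments go through `π`, and the result is represented by its
      -- position under `σ`.
      funTables : ∀ g → ∃[ t ] (∀ v → query t v ≡ name (σ (funᴵ M g (Vec.map π v))))
      funTables g = query-surjective (λ v → name (σ (funᴵ M g (Vec.map π v))))

      relTables : ∀ P → ∃[ t ] (∀ v → query t v ≡ encodeDec (rel? P (Vec.map π v)))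
      relTables P = query-surjective (λ v → encodeDec (rel? P (Vec.map π v)))

      F-correct = tabulateBySymbol Fun-enumerable (proj₁ ∘ funTables) N
      R-correct = tabulateBySymbol Rel-enumerable (proj₁ ∘ relTables) N
      F = proj₁ F-correct
      R = proj₁ R-correct
      V = tabulate (name ∘ σ ∘ ρ) N

      -- A value of `D` stored through `σ` is recovered by `π`, which gives the homomorphism
      -- condition for functions and the agreement of assignments.
      π-element-name : ∀ {t} d → t ≡ name (σ d) → π (element t) ≡ d
      π-element-name d refl = trans (cong π (element-name (σ d))) (π∘σ d)

      fun-hom : ∀ g → funRank g < N → ∀ v →
                π (funᴵ (tableModel m F R) g v) ≡ funᴵ M g (Vec.map π v)
      fun-hom g lt v = π-element-name _
        (trans (cong (λ t → query t v) (proj₂ F-correct g lt)) (proj₂ (funTables g) v))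

      rel-hom : ∀ P → relRank P < N → ∀ v →
                relᴵ (tableModel m F R) P v ⇔ relᴵ M P (Vec.map π v)
      rel-hom P lt v = subst (λ t → IsLeaf t ⇔ relᴵ M P (Vec.map π v))
        (sym (trans (cong (λ t → query t v) (proj₂ R-correct P lt)) (proj₂ (relTables P) v)))
        (isLeaf-encodeDec (rel? P (Vec.map π v)))

      assignment-agrees : ∀ n → n < N → π (tableAssignment m V n) ≡ ρ n
      assignment-agrees n lt = π-element-name _ (get-tabulate (name ∘ σ ∘ ρ) lt)

    FSAT⇔satisfiedBy : ∀ φ → FSAT ℓ S φ ⇔ ∃ (SatisfiedBy ℓ φ)
    -- Conversely, the table model is itself a finite decidable model.
    FSAT⇔satisfiedBy φ = mk⇔ (FSAT⇒satisfiedBy φ) λ (t , sat) →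
      _ , lift-fin-finite _ , _ , tableModel-decidable _ (get t 1) (get t 2) , _ , sat

theorem36 : ∀ {f p ℓ : Level} (S : Signature f p) →
    DataType (Signature.Fun S) → DataType (Signature.Rel S) →
    EnumerablePred (FSAT ℓ S)
theorem36 S (Fun-enum , _) (Rel-enum , _) =
  enumerable-resp-⇔ (FSAT⇔satisfiedBy Fun-enum Rel-enum)
    (∃-enumerable (formula-enumerable Fun-enum Rel-enum) tree-enumerable
      (satisfiedBy? Fun-enum Rel-enum))
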